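{- Let $G=(V,E)$ be a graph with maximum degree $\Delta(G)$ and let $S\subset V$ be such that $G[S]$ is a proportionally dense subgraph. Then $|S|\le\left\lfloor\frac{|V|\cdot(\Delta(G)-1)+1}{\Delta(G)}\right\rfloor$.
   Context: All graphs are finite, simple, undirected and connected. For a graph $G=(V,E)$, $d(v)$ is the degree of $v\in V$, $N(v)$ its set of neighbors, and for $S\subset V$, $d_S(v)=|N(v)\cap S|$, $\overline{S}=V\setminus S$, and $G[S]$ is the subgraph induced by $S$. For $S\subset V$ with $2\le |S|<|V|$, the induced subgraph $G[S]$ is a proportionally dense subgraph (PDS) if every $u\in S$ satisfies $\frac{d_S(u)}{|S|-1}\ge \frac{d(u)}{|V|-1}$ (equivalently $\frac{d_S(u)}{|S|-1}\ge\frac{d_{\overline{S}}(u)}{|\overline{S}|}$). A PDS is not required to be connected. -}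

module Defs where

open import Data.Fin using (Fin; zero; suc)
open import Data.Fin.Subset using (Subset; _∈_; _∩_; ∣_∣)
open import Data.Fin.Subset.Properties using (x∈p⇒∣p-x∣<∣p∣)
open import Data.Integer using (+_)
open import Data.List using (map; allFin)
open import Data.List.Extrema.Nat using (max; v≤max⁺)
open import Data.List.Membership.Propositional.Properties using (∈-allFin)
import Data.List.Relation.Unary.Any as Any
import Data.List.Relation.Unary.Any.Properties as Any
open import Data.Nat using (ℕ; zero; suc; _∸_; _≤_; _<_; NonZero; z≤n; s≤s; >-nonZero)
open import Data.Nat.Properties using (≤-reflexive; ≤-<-trans; <-≤-trans; ≤-trans; <⇒≤; m<n⇒0<n∸m)
import Data.Rational.Unnormalised as ℚᵘ
open import Data.Sum using (inj₂)
open import Data.Vec using (tabulate)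
open import Data.Vec.Properties using (lookup⇒[]=; lookup∘tabulate)
open import Level using (0ℓ)
open import Relation.Binary using (Rel; Decidable; Symmetric)
open import Relation.Binary.Construct.Closure.ReflexiveTransitive using (Star; _◅_)
open import Relation.Binary.PropositionalEquality using (cong; trans)
open import Relation.Nullary using (¬_; does)
open import Relation.Nullary.Decidable using (dec-true)

record Graph (n : ℕ) : Set₁ where
  infix 4 _~_ _~?_
  field
    _~_      : Rel (Fin n) 0ℓ
    _~?_     : Decidable _~_
    ~-sym    : Symmetric _~_
    ~-irrefl : ∀ v → ¬ (v ~ v)

  N : Fin n → Subset n
  N v = tabulate (λ w → does (v ~? w))

  d : Fin n → ℕ
  d v = ∣ N v ∣

  -- dIn S v is d_S(v), the number of neighbours of v inside S.
  dIn : Subset n → Fin n → ℕ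
  dIn S v = ∣ N v ∩ S ∣

  -- Maximum degree; the default 0 of max only matters when n ≡ 0.
  Δ : ℕ
  Δ = max 0 (map d (allFin n))

  Connected : Set
  Connected = ∀ u v → Star _~_ u v

open Graph public using (Connected; Δ)

-- G[S] is a proportionally dense subgraph of G.  S need not induce a connected
-- subgraph.  On unnormalised rationals _≥_ is comparison by cross-multiplication.
record IsPDS {n : ℕ} (G : Graph n) (S : Subset n) : Set where
  open Graph G using (d; dIn)
  field
    2≤∣S∣ : 2 ≤ ∣ S ∣
    ∣S∣<n : ∣ S ∣ < n

  2≤n : 2 ≤ n
  2≤n = ≤-trans 2≤∣S∣ (<⇒≤ ∣S∣<n)

  instance
    ∣S∣∸1-nonZero : NonZero (∣ S ∣ ∸ 1)
    ∣S∣∸1-nonZero = >-nonZero (m<n⇒0<n∸m 2≤∣S∣)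

    n∸1-nonZero : NonZero (n ∸ 1)
    n∸1-nonZero = >-nonZero (m<n⇒0<n∸m 2≤n)

  field
    dense : ∀ u → u ∈ S →
            (+ dIn S u) ℚᵘ./ (∣ S ∣ ∸ 1) ℚᵘ.≥ (+ d u) ℚᵘ./ (n ∸ 1)

module _ {n : ℕ} (G : Graph n) where
  open Graph G using (_~_; _~?_; N; d)

  ~⇒∈N : ∀ {v w} → v ~ w → w ∈ N v
  ~⇒∈N {v} {w} v~w = lookup⇒[]= w (N v)
    (trans (lookup∘tabulate (λ x → does (v ~? x)) w) (dec-true (v ~? w) v~w))

  d≤Δ : ∀ v → d v ≤ Δ G
  d≤Δ v = v≤max⁺ 0 (map d (allFin n))
    (inj₂ (Any.map⁺ (Any.map (λ eq → ≤-reflexive (cong d eq)) (∈-allFin v))))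

  ~⇒Δ>0 : ∀ {v w} → v ~ w → 0 < Δ G
  ~⇒Δ>0 {v} v~w =
    <-≤-trans (≤-<-trans z≤n (x∈p⇒∣p-x∣<∣p∣ (~⇒∈N v~w))) (d≤Δ v)

connected⇒Δ>0 : ∀ {n} (G : Graph n) → 2 ≤ n → Connected G → 0 < Δ G
connected⇒Δ>0 {suc (suc _)} G _ conn with conn zero (suc zero)
... | 0~w ◅ _ = ~⇒Δ>0 G 0~w
connected⇒Δ>0 {suc zero} _ (s≤s ()) _

-- Makes division by Δ G meaningful without assuming Δ G ≢ 0 separately.
Δ-nonZero : ∀ {n} {G : Graph n} {S : Subset n} →
            Connected G → IsPDS G S → NonZero (Δ G)
Δ-nonZero {G = G} conn pds = >-nonZero (connected⇒Δ>0 G (IsPDS.2≤n pds) conn)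

{-# OPTIONS --safe #-}

-- Since G is connected and S is a nonempty proper subset, some u ∈ S has a
-- neighbour outside S, so d_S(u) ≤ d(u) − 1.  Proportional density at u then
-- gives d(u) (|S| − 1) ≤ (d(u) − 1) (n − 1), that is n − 1 ≤ d(u) (n − |S|);
-- the right-hand side only grows when d(u) is replaced by Δ, which rearranges
-- to |S| Δ ≤ n (Δ − 1) + 1.
module Submission where

open import Defs
open import Data.Nat using (ℕ; _+_; _*_; _∸_; _≤_; _/_)
open import Data.Fin.Subset using (Subset; ∣_∣)

open import Data.Fin.Subset using (_∈_; _∉_; ∁; Nonempty)
open import Data.Fin.Subset.Properties
  using (_∈?_; nonempty?; Empty-unique; ∣⊥∣≡0; ∣∁p∣≡n∸∣p∣; x∈∁p⇒x∉p;
         p∩q⊆p; p∩q⊆q; p⊂q⇒∣p∣<∣q∣)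
open import Data.Integer using (+_)
import Data.Integer as ℤ
import Data.Integer.Properties as ℤ
open import Data.Nat using (suc; _<_; NonZero; s≤s)
open import Data.Nat.DivMod using (m*n/n≡m; /-monoˡ-≤)
open import Data.Nat.Properties
open import Data.Nat.Tactic.RingSolver using (solve-∀)
open import Data.Product using (_×_; _,_; ∃₂)
import Data.Rational.Unnormalised as ℚᵘ
import Data.Rational.Unnormalised.Properties as ℚᵘ
open import Relation.Binary.Construct.Closure.ReflexiveTransitive using (Star; ε; _◅_)
open import Relation.Binary.PropositionalEquality using (_≡_; refl; sym; trans; cong; subst; subst₂)
open import Relation.Nullary using (¬_; yes; no; contradiction)
open import Relation.Unary using (Pred; Decidable)

-- Walk along the path, testing `P` at each new vertex: the first failure ends the wanted step.
Star-exits : ∀ {a r p} {A : Set a} {_~_ : A → A → Set r} {P : Pred A p} → Decidable P →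
             ∀ {u v} → Star _~_ u v → P u → ¬ P v →
             ∃₂ λ x y → x ~ y × P x × ¬ P y
Star-exits P? ε                    Pu ¬Pv = contradiction Pu ¬Pv
Star-exits P? (_◅_ {j = w} u~w w~*v) Pu ¬Pv with P? w
... | yes Pw = Star-exits P? w~*v Pw ¬Pv
... | no ¬Pw = _ , w , u~w , Pu , ¬Pw

0<∣p∣⇒Nonempty : ∀ {n} (p : Subset n) → 0 < ∣ p ∣ → Nonempty p
0<∣p∣⇒Nonempty {n} p 0<∣p∣ with nonempty? p
... | yes ne = ne
... | no ¬ne = contradiction (trans (cong ∣_∣ (Empty-unique ¬ne)) (∣⊥∣≡0 n)) (m<n⇒n≢0 0<∣p∣)

/-≤-/⇒*-≤-* : ∀ a b c d .{{_ : NonZero b}} .{{_ : NonZero d}} →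
              (+ a) ℚᵘ./ b ℚᵘ.≤ (+ c) ℚᵘ./ d → a * d ≤ c * b
-- Exposing both denominators as successors lets the fractions compute, so their order unfolds to
-- cross-multiplication over the integers.
/-≤-/⇒*-≤-* a b@(suc _) c d@(suc _) le = ℤ.drop‿+≤+
  (subst₂ ℤ._≤_ (sym (ℤ.pos-* a d)) (sym (ℤ.pos-* c b)) (ℚᵘ.drop-*≤* le))

m*o≤n⇒m≤n/o : ∀ m n o .{{_ : NonZero o}} → m * o ≤ n → m ≤ n / o
m*o≤n⇒m≤n/o m n o le = subst (_≤ n / o) (m*n/n≡m m o) (/-monoˡ-≤ o le)

module _ {n} (G : Graph n) (S : Subset n) where
  open Graph G using (_~_; N; d; dIn)

  -- `v` witnesses that the inclusion of `N u ∩ S` in `N u` is strict.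
  dIn<d : ∀ {u v} → u ~ v → v ∉ S → dIn S u < d u
  dIn<d {u} {v} u~v v∉S = p⊂q⇒∣p∣<∣q∣
    (p∩q⊆p (N u) S , v , ~⇒∈N G u~v , λ v∈ → v∉S (p∩q⊆q (N u) S v∈))

  -- Both `S` and `∁ S` are inhabited, and a path from the first to the second must leave `S`.
  crossing-edge : Connected G → 0 < ∣ S ∣ → ∣ S ∣ < n →
                  ∃₂ λ u v → u ~ v × u ∈ S × v ∉ S
  crossing-edge conn 0<∣S∣ ∣S∣<n
    with x , x∈S  ← 0<∣p∣⇒Nonempty S 0<∣S∣
       | y , y∈∁S ← 0<∣p∣⇒Nonempty (∁ S) (subst (0 <_) (sym (∣∁p∣≡n∸∣p∣ S)) (m<n⇒0<n∸m ∣S∣<n))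
    = Star-exits (_∈? S) (conn x y) x∈S (x∈∁p⇒x∉p y∈∁S)

density⇒s*Δ≤ : ∀ {s n e d Δ} → 0 < s → s ≤ n → e < d → d ≤ Δ →
               d * (s ∸ 1) ≤ e * (n ∸ 1) → s * Δ ≤ n * (Δ ∸ 1) + 1
density⇒s*Δ≤ {suc t} {suc m} {e} {suc d} _ (s≤s t≤m) (s≤s e≤d) d<Δ dense
  -- Here `suc d` is the degree of the chosen vertex and `k` its shortfall from the maximum, so that
  -- `Δ ∸ 1` becomes `d + k`.
  with k , refl ← m≤n⇒∃[o]m+o≡n d<Δ = begin
  suc t * suc (d + k)               ≡⟨ expandˡ t d k ⟩
  -- Density with `e ≤ d` bounds the first summand by `d * m`; the shortfall term only needs
  -- `t ≤ m`.
  suc d * t + t * k + suc (d + k)   ≤⟨ +-monoˡ-≤ (suc (d + k)) (+-mono-≤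
                                         (≤-trans dense (*-monoˡ-≤ m e≤d)) (*-monoˡ-≤ k t≤m)) ⟩
  d * m + m * k + suc (d + k)       ≡⟨ expandʳ m d k ⟩
  suc m * (d + k) + 1               ∎
  where
  open ≤-Reasoning
  expandˡ : ∀ t d k → suc t * suc (d + k) ≡ suc d * t + t * k + suc (d + k)
  expandˡ = solve-∀
  expandʳ : ∀ m d k → d * m + m * k + suc (d + k) ≡ suc m * (d + k) + 1
  expandʳ = solve-∀

lemma8 : ∀ {n : ℕ} (G : Graph n) (conn : Connected G) (S : Subset n) (pds : IsPDS G S) →
    let instance Δ≢0 = Δ-nonZero conn pds in
    ∣ S ∣ ≤ (n * (Δ G ∸ 1) + 1) / Δ G
lemma8 {n} G conn S pds =
  let u , v , u~v , u∈S , v∉S = crossing-edge G S conn 0<∣S∣ ∣S∣<n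
  in m*o≤n⇒m≤n/o ∣ S ∣ (n * (Δ G ∸ 1) + 1) (Δ G) {{Δ-nonZero conn pds}}
       (density⇒s*Δ≤ 0<∣S∣ (<⇒≤ ∣S∣<n) (dIn<d G S u~v v∉S) (d≤Δ G u)
         (/-≤-/⇒*-≤-* (d u) (n ∸ 1) (dIn S u) (∣ S ∣ ∸ 1) (dense u u∈S)))
  where
  open Graph G using (d; dIn)
  open IsPDS pds
  0<∣S∣ : 0 < ∣ S ∣
  -- `2 ≤ ∣ S ∣` is `1 < ∣ S ∣`, which weakens to `1 ≤ ∣ S ∣`.
  0<∣S∣ = <⇒≤ 2≤∣S∣
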